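{- Let $p\neq q$ be primes, let $k\in\mathbb{Z}$, let $n>m\ge 2$ be integers, and let $f(X)=X^n+qk\,X^m+p^2q$. Then $f$ is non-monogenic.
   Context: A monic irreducible polynomial $f\in\mathbb{Z}[X]$ with root $\theta$ is called monogenic if $\mathbb{Z}[\theta]=\mathcal{O}_K$, where $\mathcal{O}_K$ is the ring of integers of $K=\mathbb{Q}(\theta)$, and non-monogenic if $\mathbb{Z}[\theta]\neq\mathcal{O}_K$. (The polynomial $f$ here is Eisenstein at $q$, hence irreducible over $\mathbb{Q}$.) -}

module Defs where

open import Level using (Level; _⊔_; 0ℓ) renaming (suc to lsuc)
open import Data.Nat.Base as ℕ using (ℕ; zero; suc)
open import Data.Integer.Base as ℤ using (ℤ; 0ℤ; 1ℤ)
open import Data.Rational.Base as ℚ using (ℚ)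
open import Data.Rational.Literals using (fromℤ)
open import Data.List.Base using (List; []; _∷_; map)
open import Data.Product.Base using (_×_; ∃-syntax)
open import Relation.Binary.PropositionalEquality.Core using (_≡_)
open import Relation.Nullary.Negation.Core using (¬_)
open import Relation.Unary using (Pred; _≐_)
open import Algebra.Bundles using (CommutativeRing)
open import Algebra.Bundles.Raw using (RawSemiring)
open import Algebra.Apartness.Bundles using (HeytingField; HeytingCommutativeRing)
open import Algebra.Morphism.Structures using (IsRingHomomorphism)
import Algebra.Definitions.RawSemiring as RawSemiringDefs

infix  4 _≈ᴾ_
infixl 6 _+ᴾ_
infixl 7 _*ᴾ_

-- A polynomial is its list of coefficients, constant term first.  Trailing
-- zeros are allowed, so equality of polynomials is _≈ᴾ_ and not _≡_.
Poly : Set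
Poly = List ℤ

coeff : Poly → ℕ → ℤ
coeff []      _       = 0ℤ
coeff (a ∷ f) zero    = a
coeff (a ∷ f) (suc i) = coeff f i

_≈ᴾ_ : Poly → Poly → Set
f ≈ᴾ g = ∀ i → coeff f i ≡ coeff g i

const : ℤ → Poly
const a = a ∷ []

X : Poly
X = 0ℤ ∷ 1ℤ ∷ []

_+ᴾ_ : Poly → Poly → Poly
[]      +ᴾ g       = g
(a ∷ f) +ᴾ []      = a ∷ f
(a ∷ f) +ᴾ (b ∷ g) = a ℤ.+ b ∷ f +ᴾ g

-- (a + X f) g = a g + X (f g)
_*ᴾ_ : Poly → Poly → Poly
[]      *ᴾ g = []
(a ∷ f) *ᴾ g = map (a ℤ.*_) g +ᴾ (0ℤ ∷ f *ᴾ g)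

ℤ[X] : RawSemiring 0ℓ 0ℓ
ℤ[X] = record
  { Carrier = Poly
  ; _≈_     = _≈ᴾ_
  ; _+_     = _+ᴾ_
  ; _*_     = _*ᴾ_
  ; 0#      = []
  ; 1#      = const 1ℤ
  }

open RawSemiringDefs ℤ[X] public
  using (Irreducible) renaming (_^_ to infixr 8 _^ᴾ_)

Monic : Poly → Set
Monic f = ∃[ d ] (coeff f d ≡ 1ℤ × (∀ i → d ℕ.< i → coeff f i ≡ 0ℤ))

-- A Heyting field is the constructive form of a field: with a tight apartness,
-- x # y holds exactly when x - y is invertible.  Classically, _#_ is _≉_.
-- The homomorphism from ℚ is automatically injective.
record FieldExtensionOfℚ c ℓ₁ ℓ₂ : Set (lsuc (c ⊔ ℓ₁ ⊔ ℓ₂)) where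
  field
    heytingField : HeytingField c ℓ₁ ℓ₂

  open HeytingField heytingField public

  open HeytingCommutativeRing heytingCommutativeRing public using (commutativeRing)
  open CommutativeRing commutativeRing public using (rawRing)

  field
    ι                    : ℚ → Carrier
    ι-isRingHomomorphism : IsRingHomomorphism ℚ.+-*-rawRing rawRing ι

module _ {c ℓ₁ ℓ₂ : Level} (L : FieldExtensionOfℚ c ℓ₁ ℓ₂) where
  open FieldExtensionOfℚ L

  eval : Poly → Carrier → Carrier
  eval []      x = 0#
  eval (a ∷ f) x = ι (fromℤ a) + x * eval f x

  IsRoot : Poly → Carrier → Set ℓ₁
  IsRoot f x = eval f x ≈ 0#

  -- The field ℚ(θ), as the smallest subfield of L containing θ and the image
  -- of ℚ.
  data ℚ⟨_⟩ (θ : Carrier) : Pred Carrier (c ⊔ ℓ₁) where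
    resp      : ∀ {x y} → x ≈ y → ℚ⟨ θ ⟩ x → ℚ⟨ θ ⟩ y
    rational  : ∀ r → ℚ⟨ θ ⟩ (ι r)
    generator : ℚ⟨ θ ⟩ θ
    sum       : ∀ {x y} → ℚ⟨ θ ⟩ x → ℚ⟨ θ ⟩ y → ℚ⟨ θ ⟩ (x + y)
    product   : ∀ {x y} → ℚ⟨ θ ⟩ x → ℚ⟨ θ ⟩ y → ℚ⟨ θ ⟩ (x * y)
    negation  : ∀ {x} → ℚ⟨ θ ⟩ x → ℚ⟨ θ ⟩ (- x)
    inverse   : ∀ {x y} → x * y ≈ 1# → ℚ⟨ θ ⟩ x → ℚ⟨ θ ⟩ y

  ℤ[_] : Carrier → Pred Carrier ℓ₁
  ℤ[ θ ] x = ∃[ g ] x ≈ eval g θ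

  IsIntegral : Pred Carrier ℓ₁
  IsIntegral x = ∃[ g ] (Monic g × IsRoot g x)

  𝒪ℚ⟨_⟩ : Carrier → Pred Carrier (c ⊔ ℓ₁)
  𝒪ℚ⟨ θ ⟩ x = ℚ⟨ θ ⟩ x × IsIntegral x

-- The root θ is taken in an arbitrary extension L of ℚ: for irreducible f, the
-- fields ℚ(θ) are isomorphic for all choices of L and θ.
record NonMonogenic c ℓ₁ ℓ₂ (f : Poly) : Set (lsuc (c ⊔ ℓ₁ ⊔ ℓ₂)) where
  field
    monic       : Monic f
    irreducible : Irreducible f
    ℤ[θ]≠𝒪      : (L : FieldExtensionOfℚ c ℓ₁ ℓ₂)
                  (θ : FieldExtensionOfℚ.Carrier L) → IsRoot L f θ →
                  ¬ (ℤ[_] L θ ≐ 𝒪ℚ⟨_⟩ L θ)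

{-# OPTIONS --safe #-}

-- Write f = X g + p² q.  For a root θ of f, the element β = g(θ)/p of ℚ(θ)
-- satisfies θ β = -p q, and substituting θ = -p q / β into f and clearing
-- denominators gives a polynomial for β that, divided by p² q, is monic with
-- integer coefficients because m ≥ 2.  So β is integral.  If β = h(θ) with
-- h ∈ ℤ[X], then θ is a root of X h + p q, which f must divide since it is
-- irreducible; comparing constant terms, p² q ∣ p q, which is absurd.
--
-- That f divides every integer polynomial vanishing at θ rests on a scaled
-- form of Eisenstein's criterion: if x y = c f with c ≠ 0, then x or y is
-- constant.  A nonzero r of degree d < n vanishing at θ cannot exist, since
-- pseudo-division of f by r and induction on d give c f = u r.
module Submission where

open import Defs
open import Level using (Level)
open import Algebra.Bundles using (CommutativeRing)
open import Algebra.Bundles.Raw using (RawSemiring)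
open import Algebra.Morphism.Structures using (IsRingHomomorphism)
open import Data.Nat.Base as ℕ using (ℕ; zero; suc; z≤n; s≤s; _≤_; _<_)
open import Data.Nat.Induction using (<-wellFounded)
open import Data.Nat.Primality
  using (Prime; prime⇒nonZero; prime⇒nonTrivial; prime⇒irreducible; euclidsLemma)
open import Data.Integer.Base as ℤ using (ℤ; +_; 0ℤ; 1ℤ; ∣_∣)
open import Data.Integer.Divisibility.Signed
open import Data.Integer.Tactic.RingSolver using (solve-∀)
open import Data.List.Base using ([]; _∷_; map)
open import Data.Product.Base using (_×_; _,_; ∃-syntax; proj₁)
open import Data.Rational.Literals using (fromℤ)
open import Data.Sum.Base as Sum using (_⊎_; inj₁; inj₂)
open import Function.Base using (_∘_)
open import Induction.WellFounded using (Acc; acc)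
open import Relation.Binary.Definitions using (tri<; tri≈; tri>)
open import Relation.Binary.PropositionalEquality
  using (_≡_; _≢_; refl; sym; trans; cong; cong₂; subst; module ≡-Reasoning)
open import Relation.Nullary using (¬_; yes; no; contradiction)
open import Relation.Unary using (_≐_)
import Algebra.Definitions.RawMagma as RawMagma
import Algebra.Properties.CommutativeSemiring.Exp as Exp
import Algebra.Properties.Ring as RingProperties
import Algebra.Solver.Ring.NaturalCoefficients.Default as NaturalSolver
import Data.Integer.Properties as ℤ
import Data.Nat.Divisibility as ℕ∣
import Data.Nat.Properties as ℕ
import Data.Rational.Base as ℚ
import Data.Rational.Properties as ℚ
import Data.Rational.Unnormalised.Base as ℚᵘ
import Data.Rational.Unnormalised.Properties as ℚᵘ
import Relation.Binary.Reasoning.Setoid as SetoidReasoning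

-- The divisibility of `ℤ[X]` that `Irreducible` refers to: a proof is a left cofactor together with
-- an equality up to `_≈ᴾ_`.
private module Raw = RawMagma (RawSemiring.*-rawMagma ℤ[X])
open Raw using () renaming (_∣_ to _∣ᴾ_)

-- Coefficients and degrees

coeff-+ : ∀ f g i → coeff (f +ᴾ g) i ≡ coeff f i ℤ.+ coeff g i
coeff-+ []      g       i       = sym (ℤ.+-identityˡ _)
coeff-+ (a ∷ f) []      i       = sym (ℤ.+-identityʳ _)
coeff-+ (a ∷ f) (b ∷ g) zero    = refl
coeff-+ (a ∷ f) (b ∷ g) (suc i) = coeff-+ f g i

coeff-scale : ∀ c f i → coeff (map (c ℤ.*_) f) i ≡ c ℤ.* coeff f i
coeff-scale c []      i       = sym (ℤ.*-zeroʳ c)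
coeff-scale c (a ∷ f) zero    = refl
coeff-scale c (a ∷ f) (suc i) = coeff-scale c f i

coeff-∷-* : ∀ a f g i →
  coeff ((a ∷ f) *ᴾ g) i ≡ a ℤ.* coeff g i ℤ.+ coeff (0ℤ ∷ f *ᴾ g) i
coeff-∷-* a f g i =
  trans (coeff-+ (map (a ℤ.*_) g) _ i) (cong (ℤ._+ _) (coeff-scale a g i))

coeff-const-* : ∀ a g i → coeff (const a *ᴾ g) i ≡ a ℤ.* coeff g i
coeff-const-* a g zero    = trans (coeff-∷-* a [] g 0) (ℤ.+-identityʳ _)
coeff-const-* a g (suc i) = trans (coeff-∷-* a [] g (suc i)) (ℤ.+-identityʳ _)

coeff-*-0 : ∀ f g → coeff (f *ᴾ g) 0 ≡ coeff f 0 ℤ.* coeff g 0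
coeff-*-0 []      g = refl
coeff-*-0 (a ∷ f) g = trans (coeff-∷-* a f g 0) (ℤ.+-identityʳ _)

coeff-scale-* : ∀ c f g i → coeff (map (c ℤ.*_) f *ᴾ g) i ≡ c ℤ.* coeff (f *ᴾ g) i
coeff-scale-* c []      g i = sym (ℤ.*-zeroʳ c)
coeff-scale-* c (a ∷ f) g i = begin
  coeff (map (c ℤ.*_) (a ∷ f) *ᴾ g) i
    ≡⟨ coeff-∷-* (c ℤ.* a) (map (c ℤ.*_) f) g i ⟩
  c ℤ.* a ℤ.* coeff g i ℤ.+ coeff (0ℤ ∷ map (c ℤ.*_) f *ᴾ g) i
    ≡⟨ cong₂ ℤ._+_ (ℤ.*-assoc c a _) (shift i) ⟩
  c ℤ.* (a ℤ.* coeff g i) ℤ.+ c ℤ.* coeff (0ℤ ∷ f *ᴾ g) i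
    ≡⟨ ℤ.*-distribˡ-+ c _ _ ⟨
  c ℤ.* (a ℤ.* coeff g i ℤ.+ coeff (0ℤ ∷ f *ᴾ g) i)
    ≡⟨ cong (c ℤ.*_) (coeff-∷-* a f g i) ⟨
  c ℤ.* coeff ((a ∷ f) *ᴾ g) i ∎
  where
  open ≡-Reasoning
  shift : ∀ i → coeff (0ℤ ∷ map (c ℤ.*_) f *ᴾ g) i ≡ c ℤ.* coeff (0ℤ ∷ f *ᴾ g) i
  shift zero    = sym (ℤ.*-zeroʳ c)
  shift (suc i) = coeff-scale-* c f g i

coeff-*-scale : ∀ c f g i → coeff (f *ᴾ map (c ℤ.*_) g) i ≡ c ℤ.* coeff (f *ᴾ g) i
coeff-*-scale c []      g i = sym (ℤ.*-zeroʳ c)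
coeff-*-scale c (a ∷ f) g i = begin
  coeff ((a ∷ f) *ᴾ map (c ℤ.*_) g) i
    ≡⟨ coeff-∷-* a f (map (c ℤ.*_) g) i ⟩
  a ℤ.* coeff (map (c ℤ.*_) g) i ℤ.+ coeff (0ℤ ∷ f *ᴾ map (c ℤ.*_) g) i
    ≡⟨ cong₂ ℤ._+_ (cong (a ℤ.*_) (coeff-scale c g i)) (shift i) ⟩
  a ℤ.* (c ℤ.* coeff g i) ℤ.+ c ℤ.* coeff (0ℤ ∷ f *ᴾ g) i
    ≡⟨ rearrange a c (coeff g i) (coeff (0ℤ ∷ f *ᴾ g) i) ⟩
  c ℤ.* (a ℤ.* coeff g i ℤ.+ coeff (0ℤ ∷ f *ᴾ g) i)
    ≡⟨ cong (c ℤ.*_) (coeff-∷-* a f g i) ⟨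
  c ℤ.* coeff ((a ∷ f) *ᴾ g) i ∎
  where
  open ≡-Reasoning
  shift : ∀ i → coeff (0ℤ ∷ f *ᴾ map (c ℤ.*_) g) i ≡ c ℤ.* coeff (0ℤ ∷ f *ᴾ g) i
  shift zero    = sym (ℤ.*-zeroʳ c)
  shift (suc i) = coeff-*-scale c f g i
  rearrange : ∀ a c x y → a ℤ.* (c ℤ.* x) ℤ.+ c ℤ.* y ≡ c ℤ.* (a ℤ.* x ℤ.+ y)
  rearrange = solve-∀

-- Degree below `d`, stated by coefficients since a list may end in zeros. For `d = 0` this says
-- that the polynomial is zero, and for `d = 1` that it is constant.
VanishesFrom : ℕ → Poly → Set
VanishesFrom d f = ∀ i → d ≤ i → coeff f i ≡ 0ℤ

HasDegree : Poly → ℕ → Set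
HasDegree f d = coeff f d ≢ 0ℤ × VanishesFrom (suc d) f

vanishes-tail : ∀ {d a f} → VanishesFrom (suc d) (a ∷ f) → VanishesFrom d f
vanishes-tail v i d≤i = v (suc i) (s≤s d≤i)

vanishes-∷ : ∀ {d a f} → VanishesFrom d f → VanishesFrom (suc d) (a ∷ f)
vanishes-∷ v (suc i) (s≤s d≤i) = v i d≤i

vanishes-pred : ∀ {d} f → coeff f d ≡ 0ℤ → VanishesFrom (suc d) f → VanishesFrom d f
vanishes-pred f f_d≡0 v i d≤i with ℕ.m≤n⇒m<n∨m≡n d≤i
... | inj₁ d<i  = v i d<i
... | inj₂ refl = f_d≡0

zero-or-degree : ∀ f → VanishesFrom 0 f ⊎ (∃[ d ] HasDegree f d)
zero-or-degree []      = inj₁ λ _ _ → refl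
zero-or-degree (a ∷ f) with zero-or-degree f
... | inj₂ (d , f_d≢0 , v) = inj₂ (suc d , f_d≢0 , vanishes-∷ v)
... | inj₁ v with a ℤ.≟ 0ℤ
...   | yes refl = inj₁ λ { zero _ → refl ; (suc i) _ → v i z≤n }
...   | no  a≢0  = inj₂ (0 , a≢0 , vanishes-∷ v)

degree-unique : ∀ f {d e} → HasDegree f d → HasDegree f e → d ≡ e
degree-unique f {d} {e} (f_d≢0 , vd) (f_e≢0 , ve) =
  ℕ.≤-antisym (ℕ.≮⇒≥ (f_d≢0 ∘ ve d)) (ℕ.≮⇒≥ (f_e≢0 ∘ vd e))

*-zeroˡ : ∀ f g → VanishesFrom 0 f → VanishesFrom 0 (f *ᴾ g)
*-zeroˡ []      g v i _ = refl
*-zeroˡ (a ∷ f) g v i _ = begin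
  coeff ((a ∷ f) *ᴾ g) i                          ≡⟨ coeff-∷-* a f g i ⟩
  a ℤ.* coeff g i ℤ.+ coeff (0ℤ ∷ f *ᴾ g) i       ≡⟨ cong₂ (λ x y → x ℤ.* coeff g i ℤ.+ y) (v 0 z≤n) (shift i) ⟩
  0ℤ ∎
  where
  open ≡-Reasoning
  shift : ∀ i → coeff (0ℤ ∷ f *ᴾ g) i ≡ 0ℤ
  shift zero    = refl
  shift (suc i) = *-zeroˡ f g (λ j _ → v (suc j) z≤n) i z≤n

-- The bounds are asymmetric so that no predecessor appears: degree below `i` and degree at most `j`
-- give degree below `i + j`. The induction starts at `i = 0`, where `f` is zero.
*-vanishes : ∀ i j f g → VanishesFrom i f → VanishesFrom (suc j) g →
             VanishesFrom (i ℕ.+ j) (f *ᴾ g)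
*-vanishes zero    j f       g vf vg k       _          = *-zeroˡ f g vf k z≤n
*-vanishes (suc i) j []      g vf vg k       _          = refl
*-vanishes (suc i) j (a ∷ f) g vf vg (suc k) (s≤s i+j≤k) = begin
  coeff ((a ∷ f) *ᴾ g) (suc k)                ≡⟨ coeff-∷-* a f g (suc k) ⟩
  a ℤ.* coeff g (suc k) ℤ.+ coeff (f *ᴾ g) k
    ≡⟨ cong₂ (λ x y → a ℤ.* x ℤ.+ y)
         (vg (suc k) (s≤s (ℕ.≤-trans (ℕ.m≤n+m j i) i+j≤k)))
         (*-vanishes i j f g (vanishes-tail vf) vg k i+j≤k) ⟩
  a ℤ.* 0ℤ ℤ.+ 0ℤ                             ≡⟨ cong (ℤ._+ 0ℤ) (ℤ.*-zeroʳ a) ⟩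
  0ℤ ∎
  where open ≡-Reasoning

-- Every other pair of indices with sum `i + j` has its first index above `i` or its second above
-- `j`, so a single term of the convolution survives.
coeff-*-top : ∀ i j f g → VanishesFrom (suc i) f → VanishesFrom (suc j) g →
              coeff (f *ᴾ g) (i ℕ.+ j) ≡ coeff f i ℤ.* coeff g j
coeff-*-top i j []            g vf vg = refl
coeff-*-top zero j (a ∷ f)    g vf vg = begin
  coeff ((a ∷ f) *ᴾ g) j                      ≡⟨ coeff-∷-* a f g j ⟩
  a ℤ.* coeff g j ℤ.+ coeff (0ℤ ∷ f *ᴾ g) j   ≡⟨ cong (λ y → a ℤ.* coeff g j ℤ.+ y) (shift j) ⟩
  a ℤ.* coeff g j ℤ.+ 0ℤ                      ≡⟨ ℤ.+-identityʳ _ ⟩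
  a ℤ.* coeff g j ∎
  where
  open ≡-Reasoning
  shift : ∀ j → coeff (0ℤ ∷ f *ᴾ g) j ≡ 0ℤ
  shift zero    = refl
  shift (suc j) = *-zeroˡ f g (vanishes-tail vf) j z≤n
coeff-*-top (suc i) j (a ∷ f) g vf vg = begin
  coeff ((a ∷ f) *ᴾ g) (suc i ℕ.+ j)
    ≡⟨ coeff-∷-* a f g (suc i ℕ.+ j) ⟩
  a ℤ.* coeff g (suc (i ℕ.+ j)) ℤ.+ coeff (f *ᴾ g) (i ℕ.+ j)
    ≡⟨ cong₂ (λ x y → a ℤ.* x ℤ.+ y) (vg _ (s≤s (ℕ.m≤n+m j i)))
         (coeff-*-top i j f g (vanishes-tail vf) vg) ⟩
  a ℤ.* 0ℤ ℤ.+ coeff f i ℤ.* coeff g j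
    ≡⟨ cong (ℤ._+ coeff f i ℤ.* coeff g j) (ℤ.*-zeroʳ a) ⟩
  0ℤ ℤ.+ coeff f i ℤ.* coeff g j
    ≡⟨ ℤ.+-identityˡ _ ⟩
  coeff f i ℤ.* coeff g j ∎
  where open ≡-Reasoning

*-nonzero : ∀ {a b} → a ≢ 0ℤ → b ≢ 0ℤ → a ℤ.* b ≢ 0ℤ
*-nonzero {a} a≢0 b≢0 ab≡0 with ℤ.i*j≡0⇒i≡0∨j≡0 a ab≡0
... | inj₁ a≡0 = a≢0 a≡0
... | inj₂ b≡0 = b≢0 b≡0

*-degree : ∀ {f g d e} → HasDegree f d → HasDegree g e → HasDegree (f *ᴾ g) (d ℕ.+ e)
*-degree {f} {g} {d} {e} (f_d≢0 , vf) (g_e≢0 , vg) =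
  subst (_≢ 0ℤ) (sym (coeff-*-top d e f g vf vg)) (*-nonzero f_d≢0 g_e≢0) ,
  *-vanishes (suc d) e f g vf vg

*-zeroʳ : ∀ f g → VanishesFrom 0 g → VanishesFrom 0 (f *ᴾ g)
*-zeroʳ []      g v i _ = refl
*-zeroʳ (a ∷ f) g v i _ = begin
  coeff ((a ∷ f) *ᴾ g) i                      ≡⟨ coeff-∷-* a f g i ⟩
  a ℤ.* coeff g i ℤ.+ coeff (0ℤ ∷ f *ᴾ g) i   ≡⟨ cong₂ (λ x y → a ℤ.* x ℤ.+ y) (v i z≤n) (shift i) ⟩
  a ℤ.* 0ℤ ℤ.+ 0ℤ                             ≡⟨ cong (ℤ._+ 0ℤ) (ℤ.*-zeroʳ a) ⟩
  0ℤ ∎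
  where
  open ≡-Reasoning
  shift : ∀ i → coeff (0ℤ ∷ f *ᴾ g) i ≡ 0ℤ
  shift zero    = refl
  shift (suc i) = *-zeroʳ f g v i z≤n

-- A zero factor would make the product zero, and degrees add because `ℤ` has no zero divisors.
factor-degrees : ∀ {n} f g → HasDegree (f *ᴾ g) n →
  ∃[ d ] ∃[ e ] (HasDegree f d × HasDegree g e × d ℕ.+ e ≡ n)
factor-degrees {n} f g fg@(fg_n≢0 , _) with zero-or-degree f | zero-or-degree g
... | inj₁ vf       | _             = contradiction (*-zeroˡ f g vf n z≤n) fg_n≢0
... | inj₂ _        | inj₁ vg       = contradiction (*-zeroʳ f g vg n z≤n) fg_n≢0
... | inj₂ (d , hd) | inj₂ (e , he) = d , e , hd , he , degree-unique (f *ᴾ g) (*-degree {f} {g} hd he) fg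

-- Division with remainder

-- Horner's scheme: a quotient and remainder for f give those for b + X f.
pseudo-division : ∀ d g → VanishesFrom (suc d) g → ∀ f →
  ∃[ N ] ∃[ u ] ∃[ r ] (VanishesFrom d r ×
    map (coeff g d ℤ.^ N ℤ.*_) f ≈ᴾ u *ᴾ g +ᴾ r)
pseudo-division d g vg []      = 0 , [] , [] , (λ _ _ → refl) , λ _ → refl
pseudo-division d g vg (b ∷ f) with pseudo-division d g vg f
... | N , u , r , vr , eq = suc N , lead ∷ map (a ℤ.*_) u , r′ , vr′ , eq′
  where
  open ≡-Reasoning
  -- If `a^N f = u g + r`, then `a^N (b + X f) = X u g + t`. Multiplying by `a` once more allows
  -- `lead` times `g` to be subtracted from `a t`, which cancels the coefficient at `d`.
  a    = coeff g d
  t    = a ℤ.^ N ℤ.* b ∷ r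
  lead = coeff t d
  r′   = map (a ℤ.*_) t +ᴾ map (ℤ.- lead ℤ.*_) g

  coeff-r′ : ∀ i → coeff r′ i ≡ a ℤ.* coeff t i ℤ.+ ℤ.- lead ℤ.* coeff g i
  coeff-r′ i = trans (coeff-+ (map (a ℤ.*_) t) (map (ℤ.- lead ℤ.*_) g) i)
                     (cong₂ ℤ._+_ (coeff-scale a t i) (coeff-scale (ℤ.- lead) g i))

  vr′ : VanishesFrom d r′
  vr′ = vanishes-pred r′
    (trans (coeff-r′ d) (cancel a lead))
    (λ i d<i → trans (coeff-r′ i)
      (trans (cong₂ (λ x y → a ℤ.* x ℤ.+ ℤ.- lead ℤ.* y) (vanishes-∷ {a = a ℤ.^ N ℤ.* b} {f = r} vr i d<i) (vg i d<i))
             (zeros a lead)))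
    where
    cancel : ∀ x y → x ℤ.* y ℤ.+ ℤ.- y ℤ.* x ≡ 0ℤ
    cancel = solve-∀
    zeros : ∀ x y → x ℤ.* 0ℤ ℤ.+ ℤ.- y ℤ.* 0ℤ ≡ 0ℤ
    zeros = solve-∀

  shift : ∀ i → coeff (map (a ℤ.^ suc N ℤ.*_) (b ∷ f)) i ≡
                coeff (0ℤ ∷ map (a ℤ.*_) u *ᴾ g) i ℤ.+ a ℤ.* coeff t i
  shift zero    = trans (ℤ.*-assoc a _ b) (sym (ℤ.+-identityˡ _))
  shift (suc i) = begin
    coeff (map (a ℤ.^ suc N ℤ.*_) f) i              ≡⟨ coeff-scale (a ℤ.^ suc N) f i ⟩
    a ℤ.* a ℤ.^ N ℤ.* coeff f i                     ≡⟨ ℤ.*-assoc a _ _ ⟩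
    a ℤ.* (a ℤ.^ N ℤ.* coeff f i)                   ≡⟨ cong (a ℤ.*_) (coeff-scale (a ℤ.^ N) f i) ⟨
    a ℤ.* coeff (map (a ℤ.^ N ℤ.*_) f) i            ≡⟨ cong (a ℤ.*_) (trans (eq i) (coeff-+ (u *ᴾ g) r i)) ⟩
    a ℤ.* (coeff (u *ᴾ g) i ℤ.+ coeff r i)          ≡⟨ ℤ.*-distribˡ-+ a _ _ ⟩
    a ℤ.* coeff (u *ᴾ g) i ℤ.+ a ℤ.* coeff r i      ≡⟨ cong (ℤ._+ a ℤ.* coeff r i) (coeff-scale-* a u g i) ⟨
    coeff (map (a ℤ.*_) u *ᴾ g) i ℤ.+ a ℤ.* coeff r i ∎

  eq′ : map (a ℤ.^ suc N ℤ.*_) (b ∷ f) ≈ᴾ (lead ∷ map (a ℤ.*_) u) *ᴾ g +ᴾ r′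
  eq′ i = begin
    coeff (map (a ℤ.^ suc N ℤ.*_) (b ∷ f)) i
      ≡⟨ shift i ⟩
    w ℤ.+ a ℤ.* coeff t i
      ≡⟨ regroup w (a ℤ.* coeff t i) lead (coeff g i) ⟩
    lead ℤ.* coeff g i ℤ.+ w ℤ.+ (a ℤ.* coeff t i ℤ.+ ℤ.- lead ℤ.* coeff g i)
      ≡⟨ cong₂ ℤ._+_ (coeff-∷-* lead (map (a ℤ.*_) u) g i) (coeff-r′ i) ⟨
    coeff ((lead ∷ map (a ℤ.*_) u) *ᴾ g) i ℤ.+ coeff r′ i
      ≡⟨ coeff-+ ((lead ∷ map (a ℤ.*_) u) *ᴾ g) r′ i ⟨
    coeff ((lead ∷ map (a ℤ.*_) u) *ᴾ g +ᴾ r′) i ∎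
    where
    w = coeff (0ℤ ∷ map (a ℤ.*_) u *ᴾ g) i
    regroup : ∀ w x l y → w ℤ.+ x ≡ l ℤ.* y ℤ.+ w ℤ.+ (x ℤ.+ ℤ.- l ℤ.* y)
    regroup = solve-∀

+-vanishingʳ : ∀ f g → VanishesFrom 0 g → f +ᴾ g ≈ᴾ f
+-vanishingʳ f g v i = trans (coeff-+ f g i)
  (trans (cong (λ z → coeff f i ℤ.+ z) (v i z≤n)) (ℤ.+-identityʳ _))

-- The scaling factor in pseudo-division is a power of the leading coefficient, hence 1 here.
monic-division : ∀ d g → coeff g d ≡ 1ℤ → VanishesFrom (suc d) g → ∀ f →
  ∃[ u ] ∃[ r ] (VanishesFrom d r × f ≈ᴾ u *ᴾ g +ᴾ r)
monic-division d g g_d≡1 vg f with N , u , r , vr , eq ← pseudo-division d g vg f =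
  u , r , vr , λ i → begin
    coeff f i                               ≡⟨ ℤ.*-identityˡ _ ⟨
    1ℤ ℤ.* coeff f i                        ≡⟨ cong (ℤ._* coeff f i) (trans (cong (ℤ._^ N) g_d≡1) (ℤ.^-zeroˡ N)) ⟨
    coeff g d ℤ.^ N ℤ.* coeff f i           ≡⟨ coeff-scale (coeff g d ℤ.^ N) f i ⟨
    coeff (map (coeff g d ℤ.^ N ℤ.*_) f) i  ≡⟨ eq i ⟩
    coeff (u *ᴾ g +ᴾ r) i                   ∎
  where open ≡-Reasoning

-- Eisenstein polynomials

-- Modulo `N`, the polynomial is a multiple of `X^d`.
DividesBelow : ℤ → ℕ → Poly → Set
DividesBelow N d f = ∀ i → i < d → N ∣ coeff f i

i∣0 : ∀ {N} → N ∣ 0ℤ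
i∣0 = divides 0ℤ refl

*-dividesBelow : ∀ {N} j f g → DividesBelow N j g → DividesBelow N j (f *ᴾ g)
*-dividesBelow {N} j []      g dg i       _   = i∣0
*-dividesBelow {N} j (a ∷ f) g dg i       i<j =
  subst (N ∣_) (sym (coeff-∷-* a f g i))
    (∣m∣n⇒∣m+n (∣n⇒∣m*n a (dg i i<j)) (shift i i<j))
  where
  shift : ∀ i → i < j → N ∣ coeff (0ℤ ∷ f *ᴾ g) i
  shift zero    _   = i∣0
  shift (suc i) i<j = *-dividesBelow j f g dg i (ℕ.<-trans (ℕ.n<1+n i) i<j)

-- The counterpart of `coeff-*-top` at the low end: modulo `N`, the factors are multiples of `X^i`
-- and `X^j`, so the coefficient of the product at `i + j` is congruent to the single term
-- `f_i g_j`.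
coeff-*-bottom : ∀ {N} i j f g → DividesBelow N i f → DividesBelow N j g →
  N ∣ coeff (f *ᴾ g) (i ℕ.+ j) → N ∣ coeff f i ℤ.* coeff g j
coeff-*-bottom {N} i       j []      g df dg _ = i∣0
coeff-*-bottom {N} zero    j (a ∷ f) g df dg h =
  ∣m+n∣n⇒∣m (subst (N ∣_) (coeff-∷-* a f g j) h) (shift j dg)
  where
  shift : ∀ j → DividesBelow N j g → N ∣ coeff (0ℤ ∷ f *ᴾ g) j
  shift zero    _  = i∣0
  shift (suc j) dg = *-dividesBelow (suc j) f g dg j (ℕ.n<1+n j)
coeff-*-bottom {N} (suc i) j (a ∷ f) g df dg h =
  coeff-*-bottom i j f g (λ k k<i → df (suc k) (s≤s k<i)) dg
    (∣m+n∣m⇒∣n (subst (N ∣_) (coeff-∷-* a f g (suc i ℕ.+ j)) h)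
               (∣m⇒∣m*n (coeff g (suc (i ℕ.+ j))) (df 0 (s≤s z≤n))))

-- Modulo `N`, either `f` is zero or it has a lowest nonzero coefficient; divisibility in `ℤ` is
-- decidable, so a scan from the constant term finds it.
multiple-or-bottom : ∀ N f →
  (∃[ f′ ] f ≡ map (N ℤ.*_) f′) ⊎ (∃[ i ] (¬ N ∣ coeff f i × DividesBelow N i f))
multiple-or-bottom N []      = inj₁ ([] , refl)
multiple-or-bottom N (a ∷ f) with N ∣? a
... | no N∤a = inj₂ (0 , N∤a , λ _ ())
... | yes N∣a@(divides b refl) with multiple-or-bottom N f
...   | inj₁ (f′ , refl)   = inj₁ (b ∷ f′ , cong (_∷ f) (ℤ.*-comm b N))
...   | inj₂ (i , N∤fi , df) =
  inj₂ (suc i , N∤fi , λ { zero _ → N∣a ; (suc j) (s≤s j<i) → df j j<i })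

-- Primes in ℤ

prime≢0 : ∀ {p} → Prime p → + p ≢ 0ℤ
prime≢0 {p} p-prime p≡0 = ℕ.≢-nonZero⁻¹ p (ℤ.+-injective p≡0)
  where instance _ = prime⇒nonZero p-prime

cancel-common : ∀ a b {c} → c ≢ 0ℤ → c ≡ a ℤ.* (b ℤ.* c) → 1ℤ ≡ a ℤ.* b
cancel-common a b {c} c≢0 eq = ℤ.*-cancelʳ-≡ 1ℤ (a ℤ.* b) c {{ℤ.≢-nonZero c≢0}}
  (trans (ℤ.*-identityˡ c) (trans eq (sym (ℤ.*-assoc a b c))))

euclidsLemmaℤ : ∀ {q} → Prime q → ∀ a b → + q ∣ a ℤ.* b → (+ q ∣ a) ⊎ (+ q ∣ b)
euclidsLemmaℤ {q} pr a b q∣ab =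
  Sum.map ∣ᵤ⇒∣ ∣ᵤ⇒∣
    (euclidsLemma ∣ a ∣ ∣ b ∣ pr (subst (q ℕ∣.∣_) (ℤ.abs-* a b) (∣⇒∣ᵤ q∣ab)))

prime∤1 : ∀ {q} → Prime q → ¬ + q ∣ 1ℤ
prime∤1 {q} pr q∣1 = ℕ.<⇒≢ (ℕ.nonTrivial⇒n>1 q) (sym (ℕ∣.∣1⇒≡1 (∣⇒∣ᵤ q∣1)))
  where instance _ = prime⇒nonTrivial pr

record Eisenstein (q : ℕ) (f : Poly) (n : ℕ) : Set where
  field
    prime     : Prime q
    leading   : coeff f n ≡ 1ℤ
    vanishes  : VanishesFrom (suc n) f
    lower     : DividesBelow (+ q) n f
    q²∤const  : ¬ + q ℤ.* + q ∣ coeff f 0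

  open ≡-Reasoning

  private instance
    q≢0 = prime⇒nonZero prime

  degree : HasDegree f n
  degree = (λ f_n≡0 → contradiction (trans (sym leading) f_n≡0) λ ()) , vanishes

  scaled-degree : ∀ {c g} → c ≢ 0ℤ → g ≈ᴾ map (c ℤ.*_) f → HasDegree g n
  scaled-degree {c} c≢0 eq =
    (λ g_n≡0 → *-nonzero c≢0 (proj₁ degree)
      (trans (sym (coeff-scale c f n)) (trans (sym (eq n)) g_n≡0))) ,
    λ i n<i → trans (eq i) (trans (coeff-scale c f i)
      (trans (cong (c ℤ.*_) (vanishes i n<i)) (ℤ.*-zeroʳ c)))

  -- As `f` is monic, the coefficient of `c f` at `n` is `c` itself.
  q∣scaled⇒q∣c : ∀ {c g} → g ≈ᴾ map (c ℤ.*_) f → + q ∣ coeff g n → + q ∣ c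
  q∣scaled⇒q∣c {c} eq = subst (+ q ∣_)
    (trans (eq n) (trans (coeff-scale c f n) (trans (cong (c ℤ.*_) leading) (ℤ.*-identityʳ c))))

  -- Modulo `q` the polynomial `f` is `X^n`, so only the coefficient of `c f` at `n` can be prime to
  -- `q`.
  q∤scaled⇒top : ∀ {c g} → g ≈ᴾ map (c ℤ.*_) f → ∀ k → ¬ + q ∣ coeff g k → k ≡ n
  q∤scaled⇒top {c} eq k q∤gk with ℕ.<-cmp k n
  ... | tri≈ _ k≡n _ = k≡n
  ... | tri< k<n _ _ = contradiction
    (subst (+ q ∣_) (sym (trans (eq k) (coeff-scale c f k))) (∣n⇒∣m*n c (lower k k<n))) q∤gk
  ... | tri> _ _ n<k = contradiction
    (subst (+ q ∣_) (sym (trans (eq k) (trans (coeff-scale c f k)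
      (trans (cong (c ℤ.*_) (vanishes k n<k)) (ℤ.*-zeroʳ c))))) i∣0) q∤gk

  -- With `f₀ = b q`, divisibility of `c b q` by `q²` gives that `q` divides `c b`, hence `b`, and
  -- then `q²` divides `f₀`.
  q²∤c*const : ∀ {c} → 0 < n → ¬ + q ∣ c → ¬ + q ℤ.* + q ∣ c ℤ.* coeff f 0
  q²∤c*const {c} 0<n q∤c q²∣cf₀ with divides b f₀≡bq ← lower 0 0<n =
    q²∤const (subst (+ q ℤ.* + q ∣_) (sym f₀≡bq) (*-monoˡ-∣ (+ q) q∣b))
    where
    q∣cb : + q ∣ c ℤ.* b
    q∣cb = *-cancelʳ-∣ (+ q)
      (subst (+ q ℤ.* + q ∣_) (trans (cong (c ℤ.*_) f₀≡bq) (sym (ℤ.*-assoc c b (+ q)))) q²∣cf₀)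
    q∣b : + q ∣ b
    q∣b = Sum.[ (λ q∣c → contradiction q∣c q∤c) , (λ q∣b → q∣b) ] (euclidsLemmaℤ prime c b q∣cb)

  -- If q divides x or y, cancel it against a factor of c (Gauss's lemma).
  -- Otherwise the lowest coefficients of x and y prime to q sit at indices
  -- summing to n, so at the very top, and q² divides x₀ y₀ unless d or e is 0.
  scaled-factors : ∀ c → Acc _<_ ∣ c ∣ → c ≢ 0ℤ → ∀ x y {d e} →
    VanishesFrom (suc d) x → VanishesFrom (suc e) y → d ℕ.+ e ≡ n →
    x *ᴾ y ≈ᴾ map (c ℤ.*_) f → d ≡ 0 ⊎ e ≡ 0
  scaled-factors c (acc rec) c≢0 x y {d} {e} vx vy d+e≡n eq =
    split (multiple-or-bottom (+ q) x) (multiple-or-bottom (+ q) y)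
    where
    smaller : ∀ c′ → c′ ≢ 0ℤ → ∣ c′ ∣ < ∣ c′ ℤ.* + q ∣
    smaller c′ c′≢0 = subst (∣ c′ ∣ <_) (sym (ℤ.abs-* c′ (+ q)))
      (ℕ.m<m*n ∣ c′ ∣ q (ℕ.nonTrivial⇒n>1 q))
      where instance
        _ = prime⇒nonTrivial prime
        _ = ℕ.≢-nonZero (c′≢0 ∘ ℤ.∣i∣≡0⇒i≡0)

    unscale : ∀ {d} z → VanishesFrom d (map (+ q ℤ.*_) z) → VanishesFrom d z
    unscale z v i d≤i = ℤ.*-cancelˡ-≡ (+ q) _ _
      (trans (sym (coeff-scale (+ q) z i)) (trans (v i d≤i) (sym (ℤ.*-zeroʳ (+ q)))))

    -- By `h` the prime `q` divides the coefficient of `x y = c f` at `n`, which is `c`. Cancelling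
    -- `q` leaves `x′ y′ = c′ f` with `c′` smaller in absolute value.
    descend : ∀ x′ y′ → VanishesFrom (suc d) x′ → VanishesFrom (suc e) y′ →
      (∀ i → coeff (x *ᴾ y) i ≡ + q ℤ.* coeff (x′ *ᴾ y′) i) → d ≡ 0 ⊎ e ≡ 0
    descend x′ y′ vx′ vy′ h
      with divides c′ c≡c′q ← q∣scaled⇒q∣c {c} {x *ᴾ y} eq
                                (subst (+ q ∣_) (sym (h n)) (∣m⇒∣m*n _ ∣-refl)) =
      let c′≢0 : c′ ≢ 0ℤ
          c′≢0 c′≡0 = c≢0 (trans c≡c′q (cong (ℤ._* + q) c′≡0))
      in scaled-factors c′ (rec (subst (λ z → ∣ c′ ∣ < ∣ z ∣) (sym c≡c′q) (smaller c′ c′≢0)))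
           c′≢0 x′ y′ vx′ vy′ d+e≡n λ i → ℤ.*-cancelˡ-≡ (+ q) _ _ (begin
             + q ℤ.* coeff (x′ *ᴾ y′) i         ≡⟨ trans (sym (h i)) (eq i) ⟩
             coeff (map (c ℤ.*_) f) i           ≡⟨ coeff-scale c f i ⟩
             c ℤ.* coeff f i                    ≡⟨ cong (ℤ._* coeff f i) (trans c≡c′q (ℤ.*-comm c′ (+ q))) ⟩
             + q ℤ.* c′ ℤ.* coeff f i           ≡⟨ ℤ.*-assoc (+ q) c′ _ ⟩
             + q ℤ.* (c′ ℤ.* coeff f i)         ≡⟨ cong (+ q ℤ.*_) (coeff-scale c′ f i) ⟨
             + q ℤ.* coeff (map (c′ ℤ.*_) f) i  ∎)

    split : (∃[ x′ ] x ≡ map (+ q ℤ.*_) x′) ⊎ (∃[ i ] (¬ + q ∣ coeff x i × DividesBelow (+ q) i x)) →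
            (∃[ y′ ] y ≡ map (+ q ℤ.*_) y′) ⊎ (∃[ j ] (¬ + q ∣ coeff y j × DividesBelow (+ q) j y)) →
            d ≡ 0 ⊎ e ≡ 0
    split (inj₁ (x′ , refl)) _ = descend x′ y (unscale x′ vx) vy (coeff-scale-* (+ q) x′ y)
    split (inj₂ _) (inj₁ (y′ , refl)) = descend x y′ vx (unscale y′ vy) (coeff-*-scale (+ q) x y′)
    split (inj₂ (i , q∤xi , dx)) (inj₂ (j , q∤yj , dy)) = positive d e refl refl
      where
      q∤xy : ¬ + q ∣ coeff (x *ᴾ y) (i ℕ.+ j)
      q∤xy = Sum.[ q∤xi , q∤yj ] ∘ euclidsLemmaℤ prime _ _ ∘ coeff-*-bottom i j x y dx dy

      i+j≡d+e : i ℕ.+ j ≡ d ℕ.+ e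
      i+j≡d+e = trans (q∤scaled⇒top {c} {x *ᴾ y} eq (i ℕ.+ j) q∤xy) (sym d+e≡n)

      i≤d : i ≤ d
      i≤d = ℕ.≮⇒≥ λ d<i → q∤xi (subst (+ q ∣_) (sym (vx i d<i)) i∣0)

      j≤e : j ≤ e
      j≤e = ℕ.≮⇒≥ λ e<j → q∤yj (subst (+ q ∣_) (sym (vy j e<j)) i∣0)

      -- Two indices bounded by `d` and `e` with sum `d + e` attain both bounds.
      d≤i : d ≤ i
      d≤i = ℕ.+-cancelʳ-≤ e d i (subst (_≤ i ℕ.+ e) i+j≡d+e (ℕ.+-monoʳ-≤ i j≤e))

      e≤j : e ≤ j
      e≤j = ℕ.+-cancelˡ-≤ d e j (subst (_≤ d ℕ.+ j) i+j≡d+e (ℕ.+-monoˡ-≤ j i≤d))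

      q∤c : ¬ + q ∣ c
      q∤c q∣c = q∤xy (subst (+ q ∣_) (sym (trans (eq _) (coeff-scale c f (i ℕ.+ j)))) (∣m⇒∣m*n _ q∣c))

      positive : ∀ d′ e′ → d ≡ d′ → e ≡ e′ → d ≡ 0 ⊎ e ≡ 0
      positive zero     _        d≡0  _    = inj₁ d≡0
      positive (suc _)  zero     _    e≡0  = inj₂ e≡0
      positive (suc d′) (suc e′) refl refl =
        contradiction q²∣cf₀ (q²∤c*const (subst (0 <_) d+e≡n (s≤s z≤n)) q∤c)
        where
        -- For positive `d` and `e`, index 0 lies below both `i` and `j`, so `q` divides each
        -- constant term.
        q²∣cf₀ : + q ℤ.* + q ∣ c ℤ.* coeff f 0
        q²∣cf₀ = subst (+ q ℤ.* + q ∣_)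
          (trans (sym (coeff-*-0 x y)) (trans (eq 0) (coeff-scale c f 0)))
          (∣-trans (*-monoˡ-∣ (+ q) (dx 0 (ℕ.≤-trans (s≤s z≤n) d≤i))) (*-monoʳ-∣ (coeff x 0) (dy 0 (ℕ.≤-trans (s≤s z≤n) e≤j))))

  -- Since `c f` is nonzero, both factors have exact degrees, which serve as the bounds in
  -- `scaled-factors`.
  scaled-factor-degrees : ∀ {c} → c ≢ 0ℤ → ∀ x y → x *ᴾ y ≈ᴾ map (c ℤ.*_) f →
    ∃[ d ] ∃[ e ] (HasDegree x d × HasDegree y e × d ℕ.+ e ≡ n × (d ≡ 0 ⊎ e ≡ 0))
  scaled-factor-degrees {c} c≢0 x y eq
    with d , e , hx@(_ , vx) , hy@(_ , vy) , d+e≡n ← factor-degrees x y (scaled-degree {g = x *ᴾ y} c≢0 eq) =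
    d , e , hx , hy , d+e≡n , scaled-factors c (<-wellFounded ∣ c ∣) c≢0 x y vx vy d+e≡n eq

  constant∣1 : ∀ {x} y → VanishesFrom 1 x → y ℤ.* coeff x 0 ≡ 1ℤ → const y *ᴾ x ≈ᴾ const 1ℤ
  constant∣1 {x} y v eq zero    = trans (coeff-const-* y x 0) eq
  constant∣1 {x} y v eq (suc i) = trans (coeff-const-* y x (suc i))
    (trans (cong (y ℤ.*_) (v (suc i) (s≤s z≤n))) (ℤ.*-zeroʳ y))

  -- The scaled criterion with `c = 1` makes one factor constant. The leading coefficients of the
  -- factors multiply to 1, so that constant is a unit.
  irreducible : 0 < n → Irreducible f
  irreducible 0<n = record { p∤1 = nonunit ; split-∣1 = λ {x} {y} → split x y }
    where
    -- Every multiple of `f` has constant term divisible by `q`.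
    nonunit : ¬ (f ∣ᴾ const 1ℤ)
    nonunit (g Raw., gf≈1) = prime∤1 prime
      (subst (+ q ∣_) (trans (sym (coeff-*-0 g f)) (gf≈1 0)) (∣n⇒∣m*n (coeff g 0) (lower 0 0<n)))

    split : ∀ x y → f ≈ᴾ x *ᴾ y → (x ∣ᴾ const 1ℤ) ⊎ (y ∣ᴾ const 1ℤ)
    split x y eq
      with scaled-factor-degrees {1ℤ} (λ ()) x y (λ i → trans (sym (eq i)) (sym (trans (coeff-scale 1ℤ f i) (ℤ.*-identityˡ _))))
    ... | d , e , (_ , vx) , (_ , vy) , refl , d≡0⊎e≡0 = units d≡0⊎e≡0
      where
      xd*ye≡1 : coeff x d ℤ.* coeff y e ≡ 1ℤ
      xd*ye≡1 = trans (sym (coeff-*-top d e x y vx vy)) (trans (sym (eq (d ℕ.+ e))) leading)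
      units : d ≡ 0 ⊎ e ≡ 0 → (x ∣ᴾ const 1ℤ) ⊎ (y ∣ᴾ const 1ℤ)
      units (inj₁ refl) = inj₁ (const (coeff y e) Raw.,
        constant∣1 {x} (coeff y e) vx (trans (ℤ.*-comm (coeff y e) _) xd*ye≡1))
      units (inj₂ refl) = inj₂ (const (coeff x d) Raw., constant∣1 {y} (coeff x d) vy xd*ye≡1)

-- Trinomials

coeff-X-* : ∀ g i → coeff (X *ᴾ g) (suc i) ≡ coeff g i
coeff-X-* g i = trans (coeff-∷-* 0ℤ (const 1ℤ) g (suc i))
  (trans (ℤ.+-identityˡ _) (trans (coeff-const-* 1ℤ g i) (ℤ.*-identityˡ _)))

coeff-Xⁿ-≡ : ∀ n → coeff (X ^ᴾ n) n ≡ 1ℤ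
coeff-Xⁿ-≡ zero    = refl
coeff-Xⁿ-≡ (suc n) = trans (coeff-X-* (X ^ᴾ n) n) (coeff-Xⁿ-≡ n)

coeff-Xⁿ-≢ : ∀ n i → i ≢ n → coeff (X ^ᴾ n) i ≡ 0ℤ
coeff-Xⁿ-≢ zero    zero    i≢n = contradiction refl i≢n
coeff-Xⁿ-≢ zero    (suc i) i≢n = refl
coeff-Xⁿ-≢ (suc n) zero    i≢n = coeff-*-0 X (X ^ᴾ n)
coeff-Xⁿ-≢ (suc n) (suc i) i≢n = trans (coeff-X-* (X ^ᴾ n) i) (coeff-Xⁿ-≢ n i (i≢n ∘ cong suc))

-- The shape shared by the polynomial of the theorem, which is an instance by definition, and the
-- monic polynomial that annihilates β.
trinomial : ℤ → ℤ → ℕ → ℕ → Poly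
trinomial a b n m = X ^ᴾ n +ᴾ const a *ᴾ X ^ᴾ m +ᴾ const b

module _ (a b : ℤ) {n m : ℕ} where

  coeff-trinomial : ∀ i → coeff (trinomial a b n m) i ≡
    coeff (X ^ᴾ n) i ℤ.+ a ℤ.* coeff (X ^ᴾ m) i ℤ.+ coeff (const b) i
  coeff-trinomial i = trans (coeff-+ (X ^ᴾ n +ᴾ const a *ᴾ X ^ᴾ m) (const b) i)
    (cong (ℤ._+ coeff (const b) i) (trans (coeff-+ (X ^ᴾ n) _ i)
      (cong (λ z → coeff (X ^ᴾ n) i ℤ.+ z) (coeff-const-* a (X ^ᴾ m) i))))

  trinomial-vanishes : m < n → VanishesFrom (suc n) (trinomial a b n m)
  trinomial-vanishes m<n (suc i) n<i
    rewrite coeff-trinomial (suc i)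
          | coeff-Xⁿ-≢ n (suc i) (ℕ.>⇒≢ n<i)
          | coeff-Xⁿ-≢ m (suc i) (ℕ.>⇒≢ (ℕ.<-trans m<n n<i))
          | ℤ.*-zeroʳ a = refl

  trinomial-leading : m < n → coeff (trinomial a b n m) n ≡ 1ℤ
  trinomial-leading (s≤s m≤n)
    rewrite coeff-trinomial n
          | coeff-Xⁿ-≡ n
          | coeff-Xⁿ-≢ m n (ℕ.>⇒≢ (s≤s m≤n))
          | ℤ.*-zeroʳ a = refl

  trinomial-monic : m < n → Monic (trinomial a b n m)
  trinomial-monic m<n = n , trinomial-leading m<n , trinomial-vanishes m<n

  trinomial-const : 0 < m → 0 < n → coeff (trinomial a b n m) 0 ≡ b
  trinomial-const 0<m 0<n
    rewrite coeff-trinomial 0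
          | coeff-Xⁿ-≢ n 0 (ℕ.<⇒≢ 0<n)
          | coeff-Xⁿ-≢ m 0 (ℕ.<⇒≢ 0<m)
          | ℤ.*-zeroʳ a = ℤ.+-identityˡ b

  trinomial-lower : ∀ {N} → N ∣ a → N ∣ b → DividesBelow N n (trinomial a b n m)
  trinomial-lower {N} N∣a N∣b i i<n
    rewrite coeff-trinomial i | coeff-Xⁿ-≢ n i (ℕ.<⇒≢ i<n) =
    ∣m∣n⇒∣m+n (∣m∣n⇒∣m+n i∣0 (∣m⇒∣m*n (coeff (X ^ᴾ m) i) N∣a)) (N∣const i)
    where
    N∣const : ∀ i → N ∣ coeff (const b) i
    N∣const zero    = N∣b
    N∣const (suc i) = i∣0

trinomial-Eisenstein : ∀ {p q} → Prime p → Prime q → p ≢ q → ∀ k {n m} → 0 < m → m < n →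
  Eisenstein q (trinomial (+ q ℤ.* k) (+ (p ℕ.^ 2 ℕ.* q)) n m) n
trinomial-Eisenstein {p} {q} p-prime q-prime p≢q k {n} {m} 0<m m<n = record
  { prime    = q-prime
  ; leading  = trinomial-leading a b {n} {m} m<n
  ; vanishes = trinomial-vanishes a b {n} {m} m<n
  ; lower    = trinomial-lower a b {n} {m} (∣m⇒∣m*n k ∣-refl) (∣ᵤ⇒∣ (ℕ∣.n∣m*n (p ℕ.^ 2)))
  ; q²∤const = λ q²∣f₀ → q∤p² (∣⇒∣ᵤ (subst (+ q ℤ.* + q ∣_) (trinomial-const a b 0<m (ℕ.<-trans 0<m m<n)) q²∣f₀))
  }
  where
  a = + q ℤ.* k
  b = + (p ℕ.^ 2 ℕ.* q)
  q∤p : ¬ q ℕ∣.∣ p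
  q∤p q∣p with prime⇒irreducible p-prime q∣p
  ... | inj₁ q≡1 = ℕ.<⇒≢ (ℕ.nonTrivial⇒n>1 q) (sym q≡1)
    where instance _ = prime⇒nonTrivial q-prime
  ... | inj₂ q≡p = p≢q (sym q≡p)
  -- Cancelling one `q` from `q² ∣ p² q` leaves `q ∣ p²`, which unfolds to `p * (p * 1)`.
  q∤p² : ¬ ∣ + q ℤ.* + q ∣ ℕ∣.∣ p ℕ.^ 2 ℕ.* q
  q∤p² q²∣p²q with euclidsLemma p (p ℕ.* 1) q-prime
      (ℕ∣.*-cancelʳ-∣ q (subst (ℕ∣._∣ p ℕ.^ 2 ℕ.* q) (ℤ.abs-* (+ q) (+ q)) q²∣p²q))
    where instance _ = prime⇒nonZero q-prime
  ... | inj₁ q∣p  = q∤p q∣p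
  ... | inj₂ q∣p1 = q∤p (subst (q ℕ∣.∣_) (ℕ.*-identityʳ p) q∣p1)

-- Roots in an extension of ℚ

-- Among unnormalised rationals equality is cross multiplication, so only an integer identity
-- remains.
fromℤ-+ : ∀ a b → fromℤ (a ℤ.+ b) ≡ fromℤ a ℚ.+ fromℤ b
fromℤ-+ a b = ℚ.toℚᵘ-injective (ℚᵘ.≃-trans (ℚᵘ.*≡* (num a b)) (ℚᵘ.≃-sym (ℚ.toℚᵘ-homo-+ (fromℤ a) (fromℤ b))))
  where
  num : ∀ a b → (a ℤ.+ b) ℤ.* 1ℤ ≡ (a ℤ.* 1ℤ ℤ.+ b ℤ.* 1ℤ) ℤ.* 1ℤ
  num = solve-∀

fromℤ-* : ∀ a b → fromℤ (a ℤ.* b) ≡ fromℤ a ℚ.* fromℤ b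
fromℤ-* a b = ℚ.toℚᵘ-injective (ℚᵘ.≃-trans (ℚᵘ.*≡* refl) (ℚᵘ.≃-sym (ℚ.toℚᵘ-homo-* (fromℤ a) (fromℤ b))))

module Extension {c ℓ₁ ℓ₂} (L : FieldExtensionOfℚ c ℓ₁ ℓ₂) where
  open FieldExtensionOfℚ L using
    (Carrier; _≈_; _+_; _*_; _-_; 0#; 1#; commutativeRing; #-irrefl; invertible⇒#; ι; ι-isRingHomomorphism)
  open CommutativeRing commutativeRing
    using ( setoid; ring; commutativeSemiring
          ; +-identityˡ; +-identityʳ; +-assoc; +-comm; +-cong; +-congˡ; +-congʳ
          ; *-identityˡ; *-identityʳ; *-assoc; *-comm; *-cong; *-congˡ; *-congʳ; zeroˡ; zeroʳ )
    renaming (refl to ≈-refl; sym to ≈-sym; trans to ≈-trans; reflexive to ≈-reflexive)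
  open Exp commutativeSemiring using (_^_; ^-homo-*; ^-distrib-*; ^-congˡ)
  open NaturalSolver commutativeSemiring using (solve; _:=_; _:+_; _:*_; con)
  open SetoidReasoning setoid
  private module ι = IsRingHomomorphism ι-isRingHomomorphism

  -- Integers in the extension field

  ⟦_⟧ : ℤ → Carrier
  ⟦ a ⟧ = ι (fromℤ a)

  ⟦⟧-+ : ∀ a b → ⟦ a ℤ.+ b ⟧ ≈ ⟦ a ⟧ + ⟦ b ⟧
  ⟦⟧-+ a b = ≈-trans (ι.⟦⟧-cong (fromℤ-+ a b)) (ι.+-homo _ _)

  ⟦⟧-* : ∀ a b → ⟦ a ℤ.* b ⟧ ≈ ⟦ a ⟧ * ⟦ b ⟧
  ⟦⟧-* a b = ≈-trans (ι.⟦⟧-cong (fromℤ-* a b)) (ι.*-homo _ _)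

  ⟦⟧-^ : ∀ a n → ⟦ a ℤ.^ n ⟧ ≈ ⟦ a ⟧ ^ n
  ⟦⟧-^ a zero    = ι.1#-homo
  ⟦⟧-^ a (suc n) = ≈-trans (⟦⟧-* a (a ℤ.^ n)) (*-congˡ (⟦⟧-^ a n))

  reciprocal : ∀ {a} → a ≢ 0ℤ → ∃[ r ] ι r * ⟦ a ⟧ ≈ 1#
  reciprocal {a} a≢0 = (ℚ.1/ fromℤ a) ,
    ≈-trans (≈-sym (ι.*-homo _ _)) (≈-trans (ι.⟦⟧-cong (ℚ.*-inverseˡ (fromℤ a))) ι.1#-homo)
    where instance _ = ℤ.≢-nonZero a≢0

  ⟦⟧-cancel : ∀ {a x} → a ≢ 0ℤ → ⟦ a ⟧ * x ≈ 0# → x ≈ 0#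
  ⟦⟧-cancel {a} {x} a≢0 ax≈0 with r , ra≈1 ← reciprocal a≢0 = begin
    x                  ≈⟨ *-identityˡ x ⟨
    1# * x             ≈⟨ *-congʳ ra≈1 ⟨
    ι r * ⟦ a ⟧ * x    ≈⟨ *-assoc _ _ _ ⟩
    ι r * (⟦ a ⟧ * x)  ≈⟨ *-congˡ ax≈0 ⟩
    ι r * 0#           ≈⟨ zeroʳ _ ⟩
    0#                 ∎

  -- The difference `1# - 0#` is invertible, with inverse `1#`, so the two elements are apart and
  -- cannot be equal.
  1≉0 : ¬ 1# ≈ 0#
  1≉0 1≈0 = #-irrefl 1≈0 (invertible⇒# (1# , left , ≈-trans (*-comm _ _) left))
    where
    left : 1# * (1# - 0#) ≈ 1#
    left = begin
      1# * (1# - 0#)  ≈⟨ *-identityˡ _ ⟩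
      1# - 0#         ≈⟨ +-congˡ (RingProperties.-0#≈0# ring) ⟩
      1# + 0#         ≈⟨ +-identityʳ 1# ⟩
      1#              ∎

  -- Equality is decided in `ℤ` rather than in the field: a nonzero integer is invertible in the
  -- field, so its vanishing would give `1# ≈ 0#`.
  ⟦⟧≈0⇒≡0 : ∀ a → ⟦ a ⟧ ≈ 0# → a ≡ 0ℤ
  ⟦⟧≈0⇒≡0 a a≈0 with a ℤ.≟ 0ℤ
  ... | yes a≡0 = a≡0
  ... | no  a≢0 = contradiction (⟦⟧-cancel a≢0 (≈-trans (*-identityʳ _) a≈0)) 1≉0

  -- Evaluation of polynomials

  eval-+ : ∀ f g x → eval L (f +ᴾ g) x ≈ eval L f x + eval L g x
  eval-+ []      g       x = ≈-sym (+-identityˡ _)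
  eval-+ (a ∷ f) []      x = ≈-sym (+-identityʳ _)
  eval-+ (a ∷ f) (b ∷ g) x = begin
    ⟦ a ℤ.+ b ⟧ + x * eval L (f +ᴾ g) x
      ≈⟨ +-cong (⟦⟧-+ a b) (*-congˡ (eval-+ f g x)) ⟩
    ⟦ a ⟧ + ⟦ b ⟧ + x * (eval L f x + eval L g x)
      ≈⟨ solve 5 (λ a b x f g → a :+ b :+ x :* (f :+ g) := a :+ x :* f :+ (b :+ x :* g)) ≈-refl _ _ _ _ _ ⟩
    ⟦ a ⟧ + x * eval L f x + (⟦ b ⟧ + x * eval L g x) ∎

  eval-scale : ∀ a f x → eval L (map (a ℤ.*_) f) x ≈ ⟦ a ⟧ * eval L f x
  eval-scale a []      x = ≈-sym (zeroʳ _)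
  eval-scale a (b ∷ f) x = begin
    ⟦ a ℤ.* b ⟧ + x * eval L (map (a ℤ.*_) f) x
      ≈⟨ +-cong (⟦⟧-* a b) (*-congˡ (eval-scale a f x)) ⟩
    ⟦ a ⟧ * ⟦ b ⟧ + x * (⟦ a ⟧ * eval L f x)
      ≈⟨ solve 4 (λ a b x f → a :* b :+ x :* (a :* f) := a :* (b :+ x :* f)) ≈-refl _ _ _ _ ⟩
    ⟦ a ⟧ * (⟦ b ⟧ + x * eval L f x) ∎

  eval-* : ∀ f g x → eval L (f *ᴾ g) x ≈ eval L f x * eval L g x
  eval-* []      g x = ≈-sym (zeroˡ _)
  eval-* (a ∷ f) g x = begin
    eval L (map (a ℤ.*_) g +ᴾ (0ℤ ∷ f *ᴾ g)) x
      ≈⟨ eval-+ (map (a ℤ.*_) g) _ x ⟩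
    eval L (map (a ℤ.*_) g) x + (⟦ 0ℤ ⟧ + x * eval L (f *ᴾ g) x)
      ≈⟨ +-cong (eval-scale a g x) (+-cong ι.0#-homo (*-congˡ (eval-* f g x))) ⟩
    ⟦ a ⟧ * eval L g x + (0# + x * (eval L f x * eval L g x))
      ≈⟨ solve 4 (λ a x f g → a :* g :+ (con 0 :+ x :* (f :* g)) := (a :+ x :* f) :* g) ≈-refl _ _ _ _ ⟩
    (⟦ a ⟧ + x * eval L f x) * eval L g x ∎

  eval-const : ∀ a x → eval L (const a) x ≈ ⟦ a ⟧
  eval-const a x = ≈-trans (+-congˡ (zeroʳ x)) (+-identityʳ _)

  eval-vanishing : ∀ f x → VanishesFrom 0 f → eval L f x ≈ 0#
  eval-vanishing []      x v = ≈-refl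
  eval-vanishing (a ∷ f) x v = begin
    ⟦ a ⟧ + x * eval L f x  ≈⟨ +-cong (≈-reflexive (cong ⟦_⟧ (v 0 z≤n)))
                                 (*-congˡ (eval-vanishing f x (λ i _ → v (suc i) z≤n))) ⟩
    ⟦ 0ℤ ⟧ + x * 0#         ≈⟨ +-cong ι.0#-homo (zeroʳ x) ⟩
    0# + 0#                 ≈⟨ +-identityʳ _ ⟩
    0#                      ∎

  eval-cong : ∀ f g x → f ≈ᴾ g → eval L f x ≈ eval L g x
  eval-cong []      g       x eq = ≈-sym (eval-vanishing g x (λ i _ → sym (eq i)))
  eval-cong (a ∷ f) []      x eq = eval-vanishing (a ∷ f) x (λ i _ → eq i)
  eval-cong (a ∷ f) (b ∷ g) x eq =
    +-cong (≈-reflexive (cong ⟦_⟧ (eq 0))) (*-congˡ (eval-cong f g x (eq ∘ suc)))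

  eval-X : ∀ x → eval L X x ≈ x
  eval-X x = begin
    ⟦ 0ℤ ⟧ + x * (⟦ 1ℤ ⟧ + x * 0#)
      ≈⟨ +-cong ι.0#-homo (*-congˡ (+-cong ι.1#-homo (zeroʳ x))) ⟩
    0# + x * (1# + 0#)
      ≈⟨ solve 1 (λ x → con 0 :+ x :* (con 1 :+ con 0) := x) ≈-refl x ⟩
    x ∎

  eval-Xⁿ : ∀ n x → eval L (X ^ᴾ n) x ≈ x ^ n
  eval-Xⁿ zero    x = ≈-trans (eval-const 1ℤ x) ι.1#-homo
  eval-Xⁿ (suc n) x = ≈-trans (eval-* X (X ^ᴾ n) x) (*-cong (eval-X x) (eval-Xⁿ n x))

  eval-trinomial : ∀ a b n m x →
    eval L (trinomial a b n m) x ≈ x ^ n + ⟦ a ⟧ * x ^ m + ⟦ b ⟧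
  eval-trinomial a b n m x = begin
    eval L (trinomial a b n m) x
      ≈⟨ eval-+ (X ^ᴾ n +ᴾ const a *ᴾ X ^ᴾ m) (const b) x ⟩
    eval L (X ^ᴾ n +ᴾ const a *ᴾ X ^ᴾ m) x + eval L (const b) x
      ≈⟨ +-cong (eval-+ (X ^ᴾ n) _ x) (eval-const b x) ⟩
    eval L (X ^ᴾ n) x + eval L (const a *ᴾ X ^ᴾ m) x + ⟦ b ⟧
      ≈⟨ +-congʳ (+-cong (eval-Xⁿ n x)
           (≈-trans (eval-* (const a) (X ^ᴾ m) x) (*-cong (eval-const a x) (eval-Xⁿ m x)))) ⟩
    x ^ n + ⟦ a ⟧ * x ^ m + ⟦ b ⟧ ∎

  eval-constant : ∀ f x → VanishesFrom 1 f → eval L f x ≈ ⟦ coeff f 0 ⟧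
  eval-constant f x v = ≈-trans
    (eval-cong f (const (coeff f 0)) x λ { zero → refl ; (suc i) → v (suc i) (s≤s z≤n) })
    (eval-const _ x)

  scale-root : ∀ {θ} a f → IsRoot L f θ → IsRoot L (map (a ℤ.*_) f) θ
  scale-root {θ} a f fθ≈0 = ≈-trans (eval-scale a f θ) (≈-trans (*-congˡ fθ≈0) (zeroʳ _))

  remainder-root : ∀ {θ} s g r u → IsRoot L s θ → IsRoot L g θ →
    s ≈ᴾ u *ᴾ g +ᴾ r → IsRoot L r θ
  remainder-root {θ} s g r u sθ≈0 gθ≈0 eq = begin
    eval L r θ                            ≈⟨ +-identityˡ _ ⟨
    0# + eval L r θ                       ≈⟨ +-congʳ (zeroʳ _) ⟨
    eval L u θ * 0# + eval L r θ          ≈⟨ +-congʳ (*-congˡ gθ≈0) ⟨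
    eval L u θ * eval L g θ + eval L r θ  ≈⟨ +-congʳ (eval-* u g θ) ⟨
    eval L (u *ᴾ g) θ + eval L r θ        ≈⟨ eval-+ (u *ᴾ g) r θ ⟨
    eval L (u *ᴾ g +ᴾ r) θ                ≈⟨ eval-cong s (u *ᴾ g +ᴾ r) θ eq ⟨
    eval L s θ                            ≈⟨ sθ≈0 ⟩
    0#                                    ∎

  -- Polynomials vanishing at a root of an Eisenstein polynomial

  module _ {q f n θ} (E : Eisenstein q f n) (fθ≈0 : IsRoot L f θ) where
    open Eisenstein E

    -- Induction on the degree bound. If `r` has exact degree `d < n`, the remainder of
    -- pseudo-dividing `f` by `r` also vanishes at `θ` and is zero by induction, so a nonzero
    -- multiple of `f` equals `u r`.
    Eisenstein-minimal : ∀ d → d ≤ n → ∀ r → VanishesFrom d r → IsRoot L r θ → VanishesFrom 0 r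
    Eisenstein-minimal zero    _   r vr rθ≈0 = vr
    Eisenstein-minimal (suc d) d<n r vr rθ≈0 with coeff r d ℤ.≟ 0ℤ
    ... | yes r_d≡0 = Eisenstein-minimal d (ℕ.<⇒≤ d<n) r (vanishes-pred r r_d≡0 vr) rθ≈0
    ... | no  r_d≢0 with N , u , r′ , vr′ , eq ← pseudo-division d r vr f =
      contradiction (scaled-factor-degrees (^-nonzero N) u r exact) impossible
      where
      ^-nonzero : ∀ N → coeff r d ℤ.^ N ≢ 0ℤ
      ^-nonzero zero    ()
      ^-nonzero (suc N) = *-nonzero r_d≢0 (^-nonzero N)

      r′≈0 : VanishesFrom 0 r′
      r′≈0 = Eisenstein-minimal d (ℕ.<⇒≤ d<n) r′ vr′
        (remainder-root (map (coeff r d ℤ.^ N ℤ.*_) f) r r′ u (scale-root (coeff r d ℤ.^ N) f fθ≈0) rθ≈0 eq)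

      exact : u *ᴾ r ≈ᴾ map (coeff r d ℤ.^ N ℤ.*_) f
      exact i = sym (trans (eq i) (+-vanishingʳ (u *ᴾ r) r′ r′≈0 i))

      impossible : ¬ (∃[ e ] ∃[ d′ ] (HasDegree u e × HasDegree r d′ × e ℕ.+ d′ ≡ n × (e ≡ 0 ⊎ d′ ≡ 0)))
      -- A constant `u` would force `d = n`; a constant `r` would be a nonzero integer that vanishes
      -- in the field.
      impossible (e , d′ , _ , hr , e+d′≡n , split) with degree-unique r hr (r_d≢0 , vr) | split
      ... | refl | inj₁ refl = ℕ.<⇒≢ d<n e+d′≡n
      ... | refl | inj₂ refl = r_d≢0 (⟦⟧≈0⇒≡0 _ (≈-trans (≈-sym (eval-constant r θ vr)) rθ≈0))

    -- Dividing by the monic `f` leaves a remainder of degree below `n` that vanishes at `θ`, hence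
    -- zero.
    Eisenstein-divides : ∀ s → IsRoot L s θ → ∃[ u ] s ≈ᴾ u *ᴾ f
    Eisenstein-divides s sθ≈0 with u , r , vr , eq ← monic-division n f leading vanishes s =
      u , λ i → trans (eq i) (+-vanishingʳ (u *ᴾ f) r
        (Eisenstein-minimal n ℕ.≤-refl r vr (remainder-root s f r u sθ≈0 fθ≈0 eq)) i)

    -- If `β = h(θ)`, then `f` divides `c + X h`; comparing constant terms, `p c` divides `c`, so
    -- `p` divides 1.
    quotient∉ℤ[θ] : ∀ {p c β} → coeff f 0 ≡ p ℤ.* c → c ≢ 0ℤ → ¬ p ∣ 1ℤ →
      θ * β + ⟦ c ⟧ ≈ 0# → ¬ ℤ[_] L θ β
    quotient∉ℤ[θ] {p} {c} {β} f₀≡pc c≢0 p∤1 θβ+c≈0 (h , β≈hθ) =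
      p∤1 (constant-divides (Eisenstein-divides (c ∷ h) s-root))
      where
      s-root : IsRoot L (c ∷ h) θ
      s-root = begin
        ⟦ c ⟧ + θ * eval L h θ  ≈⟨ +-congˡ (*-congˡ β≈hθ) ⟨
        ⟦ c ⟧ + θ * β           ≈⟨ +-comm ⟦ c ⟧ (θ * β) ⟩
        θ * β + ⟦ c ⟧           ≈⟨ θβ+c≈0 ⟩
        0#                      ∎
      constant-divides : ∃[ u ] c ∷ h ≈ᴾ u *ᴾ f → p ∣ 1ℤ
      constant-divides (u , s≈uf) = divides (coeff u 0) (cancel-common (coeff u 0) p c≢0
        (trans (s≈uf 0) (trans (coeff-*-0 u f) (cong (λ z → coeff u 0 ℤ.* z) f₀≡pc))))

  -- Substituting `θ = w / β` and clearing denominators: with `n = m + l`, the identity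
  -- `b (β^n + A β^l + B) = f(θ) β^n` holds. The equations for `A` and `B` say that dividing by `b`
  -- keeps the coefficients integral.
  reciprocal-root : ∀ {θ β a b A B w} m l → b ≢ 0ℤ →
    b ℤ.* A ≡ a ℤ.* w ℤ.^ m → b ℤ.* B ≡ w ℤ.^ (m ℕ.+ l) → θ * β ≈ ⟦ w ⟧ →
    IsRoot L (trinomial a b (m ℕ.+ l) m) θ → IsRoot L (trinomial A B (m ℕ.+ l) l) β
  reciprocal-root {θ} {β} {a} {b} {A} {B} {w} m l b≢0 bA≡awᵐ bB≡wⁿ θβ≈w fθ≈0 =
    ⟦⟧-cancel b≢0 (begin
      ⟦ b ⟧ * eval L (trinomial A B n l) β
        ≈⟨ *-congˡ (eval-trinomial A B n l β) ⟩
      ⟦ b ⟧ * (β ^ n + ⟦ A ⟧ * β ^ l + ⟦ B ⟧)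
        ≈⟨ solve 5 (λ b x A y B → b :* (x :+ A :* y :+ B) := b :* x :+ b :* A :* y :+ b :* B) ≈-refl _ _ _ _ _ ⟩
      ⟦ b ⟧ * β ^ n + ⟦ b ⟧ * ⟦ A ⟧ * β ^ l + ⟦ b ⟧ * ⟦ B ⟧
        ≈⟨ +-cong (+-congˡ (*-congʳ bA≈)) bB≈ ⟩
      ⟦ b ⟧ * β ^ n + ⟦ a ⟧ * (θ ^ m * β ^ m) * β ^ l + θ ^ n * β ^ n
        ≈⟨ +-congʳ (+-congˡ (solve 4 (λ a t x y → a :* (t :* x) :* y := a :* t :* (x :* y)) ≈-refl _ _ _ _)) ⟩
      ⟦ b ⟧ * β ^ n + ⟦ a ⟧ * θ ^ m * (β ^ m * β ^ l) + θ ^ n * β ^ n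
        ≈⟨ +-congʳ (+-congˡ (*-congˡ (^-homo-* β m l))) ⟨
      ⟦ b ⟧ * β ^ n + ⟦ a ⟧ * θ ^ m * β ^ n + θ ^ n * β ^ n
        ≈⟨ solve 4 (λ b x y t → b :* x :+ y :* x :+ t :* x := (t :+ y :+ b) :* x) ≈-refl _ _ _ _ ⟩
      (θ ^ n + ⟦ a ⟧ * θ ^ m + ⟦ b ⟧) * β ^ n
        ≈⟨ *-congʳ (eval-trinomial a b n m θ) ⟨
      eval L (trinomial a b n m) θ * β ^ n
        ≈⟨ *-congʳ fθ≈0 ⟩
      0# * β ^ n
        ≈⟨ zeroˡ _ ⟩
      0# ∎)
    where
    n = m ℕ.+ l
    wⁿ≈ : ∀ n → ⟦ w ℤ.^ n ⟧ ≈ θ ^ n * β ^ n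
    wⁿ≈ n = ≈-trans (⟦⟧-^ w n) (≈-trans (^-congˡ n (≈-sym θβ≈w)) (^-distrib-* θ β n))
    bA≈ : ⟦ b ⟧ * ⟦ A ⟧ ≈ ⟦ a ⟧ * (θ ^ m * β ^ m)
    bA≈ = ≈-trans (≈-sym (⟦⟧-* b A)) (≈-trans (≈-reflexive (cong ⟦_⟧ bA≡awᵐ))
            (≈-trans (⟦⟧-* a (w ℤ.^ m)) (*-congˡ (wⁿ≈ m))))
    bB≈ : ⟦ b ⟧ * ⟦ B ⟧ ≈ θ ^ n * β ^ n
    bB≈ = ≈-trans (≈-sym (⟦⟧-* b B)) (≈-trans (≈-reflexive (cong ⟦_⟧ bB≡wⁿ)) (wⁿ≈ n))

  ℚ⟨⟩-^ : ∀ {θ} n → ℚ⟨_⟩ L θ (θ ^ n)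
  ℚ⟨⟩-^ zero    = resp ι.1#-homo (rational ℚ.1ℚ)
  ℚ⟨⟩-^ (suc n) = product generator (ℚ⟨⟩-^ n)

  trinomial-quotient : ∀ {θ a p c n m} → p ≢ 0ℤ →
    IsRoot L (trinomial a (p ℤ.* c) (suc n) (suc m)) θ →
    ∃[ β ] (ℚ⟨_⟩ L θ β × θ * β + ⟦ c ⟧ ≈ 0#)
  trinomial-quotient {θ} {a} {p} {c} {n} {m} p≢0 fθ≈0 with r , rp≈1 ← reciprocal p≢0 =
    -- Here `ι r` is `1 / p`. The nonconstant terms of `f` share a factor `X`, and β is the value of
    -- their cofactor at `θ`, divided by `p`.
    ι r * (θ ^ n + ⟦ a ⟧ * θ ^ m) ,
    product (rational r) (sum (ℚ⟨⟩-^ n) (product (rational (fromℤ a)) (ℚ⟨⟩-^ m))) ,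
    ⟦⟧-cancel p≢0 (begin
      ⟦ p ⟧ * (θ * (ι r * (θ ^ n + ⟦ a ⟧ * θ ^ m)) + ⟦ c ⟧)
        ≈⟨ solve 7 (λ p t r x a y c → p :* (t :* (r :* (x :+ a :* y)) :+ c) :=
                                      r :* p :* (t :* x :+ a :* (t :* y)) :+ p :* c) ≈-refl _ _ _ _ _ _ _ ⟩
      ι r * ⟦ p ⟧ * (θ ^ suc n + ⟦ a ⟧ * θ ^ suc m) + ⟦ p ⟧ * ⟦ c ⟧
        ≈⟨ +-cong (≈-trans (*-congʳ rp≈1) (*-identityˡ _)) (≈-sym (⟦⟧-* p c)) ⟩
      θ ^ suc n + ⟦ a ⟧ * θ ^ suc m + ⟦ p ℤ.* c ⟧
        ≈⟨ eval-trinomial a (p ℤ.* c) (suc n) (suc m) θ ⟨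
      eval L (trinomial a (p ℤ.* c) (suc n) (suc m)) θ
        ≈⟨ fθ≈0 ⟩
      0# ∎)

  +⟦⟧≈0 : ∀ {x c} → x + ⟦ c ⟧ ≈ 0# → x ≈ ⟦ ℤ.- c ⟧
  +⟦⟧≈0 {x} {c} x+c≈0 = begin
    x                          ≈⟨ +-identityʳ x ⟨
    x + 0#                     ≈⟨ +-congˡ ι.0#-homo ⟨
    x + ⟦ 0ℤ ⟧                 ≈⟨ +-congˡ (≈-reflexive (cong ⟦_⟧ (ℤ.+-inverseʳ c))) ⟨
    x + ⟦ c ℤ.- c ⟧            ≈⟨ +-congˡ (⟦⟧-+ c (ℤ.- c)) ⟩
    x + (⟦ c ⟧ + ⟦ ℤ.- c ⟧)    ≈⟨ +-assoc _ _ _ ⟨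
    x + ⟦ c ⟧ + ⟦ ℤ.- c ⟧      ≈⟨ +-congʳ x+c≈0 ⟩
    0# + ⟦ ℤ.- c ⟧             ≈⟨ +-identityˡ _ ⟩
    ⟦ ℤ.- c ⟧                  ∎

-- Non-monogenicity of the trinomials

proposition6p3 : ∀ {c ℓ₁ ℓ₂ : Level} (p q : ℕ) → Prime p → Prime q → p ≢ q →
    (k : ℤ) (n m : ℕ) → 2 ≤ m → m < n →
    NonMonogenic c ℓ₁ ℓ₂ (X ^ᴾ n +ᴾ const (+ q ℤ.* k) *ᴾ X ^ᴾ m +ᴾ const (+ (p ℕ.^ 2 ℕ.* q)))
proposition6p3 {c} {ℓ₁} {ℓ₂} p q p-prime q-prime p≢q k n m@(suc (suc m₂)) (s≤s (s≤s _)) m<n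
  -- Writing `n = m + l` makes `l = n - m` the middle exponent of the polynomial for β.
  with l , refl ← ℕ.m≤n⇒∃[o]m+o≡n (ℕ.<⇒≤ m<n) = record
  { monic       = trinomial-monic a (+ (p ℕ.^ 2 ℕ.* q)) {n} {m} m<n
  ; irreducible = Eisenstein.irreducible f-Eisenstein (s≤s z≤n)
  ; ℤ[θ]≠𝒪      = ℤ[θ]≠𝒪
  }
  where
  a = + q ℤ.* k
  pq = + p ℤ.* + q
  -- The value of `θ β`.
  w = ℤ.- pq
  f = trinomial a (+ (p ℕ.^ 2 ℕ.* q)) n m

  f-Eisenstein : Eisenstein q f n
  f-Eisenstein = trinomial-Eisenstein p-prime q-prime p≢q k (s≤s z≤n) m<n

  p≢0 : + p ≢ 0ℤ
  p≢0 = prime≢0 p-prime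

  pq≢0 : pq ≢ 0ℤ
  pq≢0 = *-nonzero p≢0 (prime≢0 q-prime)

  const≡ : + (p ℕ.^ 2 ℕ.* q) ≡ + p ℤ.* pq
  const≡ = trans (cong +_ (trans (cong (λ z → p ℕ.* z ℕ.* q) (ℕ.*-identityʳ p)) (ℕ.*-assoc p p q)))
    (trans (ℤ.pos-* p (p ℕ.* q)) (cong (+ p ℤ.*_) (ℤ.pos-* p q)))

  f₀≡p*pq : coeff f 0 ≡ + p ℤ.* pq
  f₀≡p*pq = trans (trinomial-const a _ {n} {m} (s≤s z≤n) (s≤s z≤n)) const≡

  -- X^n + A X^(n-m) + B is (X^n / p² q) f(w / X).
  A = k ℤ.* (+ q ℤ.* + q) ℤ.* w ℤ.^ m₂
  B = + q ℤ.* w ℤ.^ (m₂ ℕ.+ l)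

  -- As `m = 2 + m₂`, two factors `w` split off from `w ^ m`; their product `p² q²` absorbs the
  -- divisor `p² q`. The same happens with `w ^ n` in `B-eq`.
  A-eq : + p ℤ.* pq ℤ.* A ≡ a ℤ.* w ℤ.^ m
  A-eq = identity (+ p) (+ q) k (w ℤ.^ m₂)
    where
    identity : ∀ p q k v → p ℤ.* (p ℤ.* q) ℤ.* (k ℤ.* (q ℤ.* q) ℤ.* v) ≡
                           q ℤ.* k ℤ.* (ℤ.- (p ℤ.* q) ℤ.* (ℤ.- (p ℤ.* q) ℤ.* v))
    identity = solve-∀

  B-eq : + p ℤ.* pq ℤ.* B ≡ w ℤ.^ n
  B-eq = identity (+ p) (+ q) (w ℤ.^ (m₂ ℕ.+ l))
    where
    identity : ∀ p q v → p ℤ.* (p ℤ.* q) ℤ.* (q ℤ.* v) ≡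
                         ℤ.- (p ℤ.* q) ℤ.* (ℤ.- (p ℤ.* q) ℤ.* v)
    identity = solve-∀

  ℤ[θ]≠𝒪 : (L : FieldExtensionOfℚ c ℓ₁ ℓ₂) (θ : FieldExtensionOfℚ.Carrier L) →
           IsRoot L f θ → ¬ (ℤ[_] L θ ≐ 𝒪ℚ⟨_⟩ L θ)
  ℤ[θ]≠𝒪 L θ fθ≈0 (_ , 𝒪⊆ℤ[θ]) =
    -- The exponents passed are `n - 1` and `m - 1`, since `trinomial-quotient` takes the successors
    -- of its arguments as exponents.
    impossible (trinomial-quotient {a = a} {+ p} {pq} {suc m₂ ℕ.+ l} {suc m₂} p≢0 fθ≈0′)
    where
    open Extension L
    open FieldExtensionOfℚ L using (_≈_; _+_; _*_; 0#)

    fθ≈0′ : IsRoot L (trinomial a (+ p ℤ.* pq) n m) θ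
    fθ≈0′ = subst (λ b → IsRoot L (trinomial a b n m) θ) const≡ fθ≈0

    impossible : ¬ (∃[ β ] (ℚ⟨_⟩ L θ β × θ * β + ⟦ pq ⟧ ≈ 0#))
    impossible (β , β∈ℚ⟨θ⟩ , θβ+pq≈0) =
      quotient∉ℤ[θ] f-Eisenstein fθ≈0 {+ p} {pq} {β} f₀≡p*pq pq≢0 (prime∤1 p-prime) θβ+pq≈0
        -- Integrality of β is witnessed by `X^n + A X^l + B`, which is monic because `l < m + l`.
        (𝒪⊆ℤ[θ] (β∈ℚ⟨θ⟩ , trinomial A B n l , trinomial-monic A B {n} {l} (ℕ.m<n+m l (s≤s z≤n)) , gβ≈0))
      where
      gβ≈0 : IsRoot L (trinomial A B n l) β
      gβ≈0 = reciprocal-root {θ} {β} {a} {+ p ℤ.* pq} {A} {B} {w} m l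
               (*-nonzero p≢0 pq≢0) A-eq B-eq (+⟦⟧≈0 θβ+pq≈0) fθ≈0′
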